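{- Let $y,q$ be indeterminates and define $\lambda_n=(1+q^ny)(1+q^ny^{ -1})$ for odd $n\ge1$ and $\lambda_n=(1-q^n)^2$ for even $n\ge 2$. Then, as formal power series in $z$, \[ \sum_{k=0}^{\infty}z^k\sum_{j=-k}^{k}y^jq^{k(k+1)-j^2} =\cfrac{1}{1+z-\cfrac{\lambda_1 z}{1+z-\cfrac{\lambda_2 z}{1+z-\cfrac{\lambda_3 z}{1+z-\cdots}}}}. \]
   Context: The infinite continued fraction (a "T-fraction") is understood as a formal power series in $z$, the limit of its finite truncations in the $z$-adic topology. -}

module Defs where

open import Level using (Level)
open import Algebra.Bundles using (CommutativeRing)
open import Data.Nat as ℕ using (ℕ; zero; suc; _∸_)
open import Data.Integer as ℤ using (ℤ; +_; -[1+_]; ∣_∣)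
open import Data.Bool using (Bool; true; false; if_then_else_)
open import Data.Fin using (Fin; toℕ)
open import Data.Vec as Vec using (Vec; _∷_; []; tabulate; zipWith; foldr)

isOdd : ℕ → Bool
isOdd zero          = false
isOdd (suc zero)    = true
isOdd (suc (suc n)) = isOdd n

-- Formal power series in z with coefficients in a commutative ring R
-- (a series is its coefficient sequence ℕ → Carrier), together with the
-- data of the theorem, for fixed ring elements q, y, y⁻ (y⁻ meant to be y⁻¹).
module Series {c ℓ : Level} (R : CommutativeRing c ℓ) where
  open CommutativeRing R

  PS : Set c
  PS = ℕ → Carrier

  pow : Carrier → ℕ → Carrier
  pow a zero    = 1#
  pow a (suc n) = a * pow a n

  sumFin : (n : ℕ) → (Fin n → Carrier) → Carrier
  sumFin n f = foldr _ _+_ 0# (tabulate f)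

  oneS : PS
  oneS zero    = 1#
  oneS (suc _) = 0#

  _⊕_ : PS → PS → PS
  (a ⊕ b) n = a n + b n

  _⊖_ : PS → PS → PS
  (a ⊖ b) n = a n - b n

  scale : Carrier → PS → PS
  scale r a n = r * a n

  zTimes : PS → PS
  zTimes a zero    = 0#
  zTimes a (suc n) = a n

  _⊛_ : PS → PS → PS
  (a ⊛ b) n = sumFin (suc n) (λ i → a (toℕ i) * b (n ∸ toℕ i))

  -- g = 1 / (1 - z f):  g₀ = 1,  g_{n+1} = Σ_{i=0}^{n} f_i g_{n-i}.
  -- geoPrefix f n = [g_n, g_{n-1}, …, g_0]
  geoPrefix : PS → (n : ℕ) → Vec Carrier (suc n)
  geoPrefix f zero    = 1# ∷ []
  geoPrefix f (suc n) =
    foldr _ _+_ 0# (zipWith _*_ (tabulate (λ (i : Fin (suc n)) → f (toℕ i))) (geoPrefix f n))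
      ∷ geoPrefix f n

  invOneMinusZ : PS → PS
  invOneMinusZ f n = Vec.head (geoPrefix f n)

  -- 1 / d  for a series d with constant term 1# : d = 1 - z·f where f n = - d (n+1)
  -- (we only ever invert series of the form 1 + z - λ z F, written as 1 - z (λF - 1))
  recip1 : PS → PS
  recip1 d = invOneMinusZ (λ n → - d (suc n))

  module Data (q y y⁻ : Carrier) where

    ypow : ℤ → Carrier
    ypow (+ n)      = pow y n
    ypow -[1+ n ]   = pow y⁻ (suc n)

    lam : ℕ → Carrier
    lam n = if isOdd n
              then (1# + pow q n * y) * (1# + pow q n * y⁻)
              else (1# - pow q n) * (1# - pow q n)

    lhs : PS
    lhs k = sumFin (suc (k ℕ.+ k)) (λ i →
              let j = (+ toℕ i) ℤ.- (+ k) in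
              ypow j * pow q (k ℕ.* suc k ∸ ∣ j ∣ ℕ.* ∣ j ∣))

    onePlusZ : PS
    onePlusZ = oneS ⊕ zTimes oneS

    cf : ℕ → ℕ → PS
    cf k zero    = recip1 onePlusZ
    cf k (suc m) = recip1 (onePlusZ ⊖ zTimes (scale (lam k) (cf (suc k) m)))

    truncation : ℕ → PS
    truncation m = cf 1 m

{-# OPTIONS --safe #-}

-- Put p = q², Q = q (y + y⁻¹) and let f be the left-hand side.  The remainders
-- Gₙ = f Qₙ − Pₙ, where Pₙ / Qₙ are the convergents, satisfy
-- Gₙ₊₁ = (1 + z) Gₙ − λₙ z Gₙ₋₁, and f equals the continued fraction as soon as
-- Gₙ = O(zⁿ).  This order of vanishing is invisible in the recurrence, but the
-- coefficients g r (K + 1) = [z^(K+r)] G₂ᵣ also obey a first-order relation in K,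
--   gᵣ₊₁(K+1) = p^(K+1) gᵣ₊₁(K)
--             + (1 − p^(r+1)) ((p^r − p^(K+1)) gᵣ(K+1) + (1 − p^(K+1+r)) gᵣ(K)),
-- from which the vanishing is immediate.  (It comes from the expansion
-- f_K = Σ_M (−1)^(K−M) p^(M(M+1)/2 − KM) [K+M, 2M]_p Π_{i<M} λ₂ᵢ₊₁, in which passing
-- to gᵣ multiplies the M-th term by (p;p)ᵣ Π_{i<r} (pⁱ − p^M).)  So g is defined by
-- the first-order relation, and the three-term recurrence is derived from it by
-- induction, which needs no division and hence works in every commutative ring.

module Submission where

open import Defs
open import Algebra.Bundles using (CommutativeRing)
open import Algebra.Solver.Ring.AlmostCommutativeRing using (fromCommutativeRing; _-Raw-AlmostCommutative⟶_)
import Algebra.Solver.Ring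
open import Data.Bool using (true; false)
open import Data.Fin using (Fin; toℕ)
open import Data.Integer as ℤ using (ℤ; +_; -[1+_]; ∣_∣)
import Data.Integer.Properties as ℤₚ
open import Data.Maybe using (Maybe; just; nothing)
open import Data.Nat as ℕ using (ℕ; zero; suc; _≤_; _<_; z≤n; s≤s; _∸_)
import Data.Nat.Properties as ℕₚ
import Data.Nat.Solver as ℕSolver
open import Data.Product using (∃; _,_)
open import Data.Sum using (inj₁; inj₂)
open import Data.Vec using (tabulate; zipWith; foldr)
open import Function using (_∘_)
open import Relation.Binary.PropositionalEquality as ≡ using (_≡_)
open import Relation.Nullary using (yes; no)

-- A ring solver with integer coefficients, and proofs by linear combination.

module IntegerCoefficients {c ℓ} (R : CommutativeRing c ℓ) where
  open CommutativeRing R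
  open import Algebra.Properties.Ring ring using (-0#≈0#; -‿distribˡ-*; -‿distribʳ-*)
  open import Algebra.Properties.AbelianGroup +-abelianGroup
    using (⁻¹-involutive; ⁻¹-∙-comm; x≈y⇒x∙y⁻¹≈ε; x∙y⁻¹≈ε⇒x≈y)
  -- With this multiplication `0 × 1#` and `1 × 1#` reduce to `0#` and `1#`, so solver constants
  -- match the ring's own by computation.
  open import Algebra.Properties.Semiring.Mult.TCOptimised semiring
  open import Relation.Binary.Reasoning.Setoid setoid

  fromℤ : ℤ → Carrier
  fromℤ (+ n)    = n × 1#
  fromℤ -[1+ n ] = - (suc n × 1#)

  fromℤ-neg : ∀ i → fromℤ (ℤ.- i) ≈ - fromℤ i
  fromℤ-neg (+ zero)  = sym -0#≈0#
  fromℤ-neg (+ suc n) = refl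
  fromℤ-neg -[1+ n ]  = sym (⁻¹-involutive _)

  fromℤ-⊖ : ∀ m n → fromℤ (m ℤ.⊖ n) ≈ m × 1# - n × 1#
  fromℤ-⊖ zero    zero    = sym (-‿inverseʳ 0#)
  fromℤ-⊖ zero    (suc n) = sym (+-identityˡ _)
  fromℤ-⊖ (suc m) zero    = sym (trans (+-congˡ -0#≈0#) (+-identityʳ _))
  fromℤ-⊖ (suc m) (suc n) = begin
    fromℤ (suc m ℤ.⊖ suc n)               ≡⟨ ≡.cong fromℤ (ℤₚ.[1+m]⊖[1+n]≡m⊖n m n) ⟩
    fromℤ (m ℤ.⊖ n)                       ≈⟨ fromℤ-⊖ m n ⟩
    m × 1# - n × 1#                       ≈⟨ +-congˡ (+-identityˡ _) ⟨
    m × 1# + (0# - n × 1#)                ≈⟨ +-congˡ (+-congʳ (-‿inverseʳ 1#)) ⟨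
    m × 1# + (1# - 1# - n × 1#)           ≈⟨ +-congˡ (+-assoc _ _ _) ⟩
    m × 1# + (1# + (- 1# - n × 1#))       ≈⟨ +-assoc _ _ _ ⟨
    m × 1# + 1# + (- 1# - n × 1#)         ≈⟨ +-cong (+-comm _ _) (⁻¹-∙-comm _ _) ⟩
    1# + m × 1# - (1# + n × 1#)           ≈⟨ +-cong (1+× m 1#) (-‿cong (1+× n 1#)) ⟨
    suc m × 1# - suc n × 1#               ∎

  fromℤ-+ : ∀ i j → fromℤ (i ℤ.+ j) ≈ fromℤ i + fromℤ j
  fromℤ-+ (+ m)    (+ n)    = ×-homo-+ 1# m n
  fromℤ-+ (+ m)    -[1+ n ] = fromℤ-⊖ m (suc n)
  fromℤ-+ -[1+ m ] (+ n)    = trans (fromℤ-⊖ n (suc m)) (+-comm _ _)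
  fromℤ-+ -[1+ m ] -[1+ n ] = begin
    - (suc (suc (m ℕ.+ n)) × 1#)          ≡⟨ ≡.cong (λ k → - (suc k × 1#)) (≡.sym (ℕₚ.+-suc m n)) ⟩
    - ((suc m ℕ.+ suc n) × 1#)            ≈⟨ -‿cong (×-homo-+ 1# (suc m) (suc n)) ⟩
    - (suc m × 1# + suc n × 1#)           ≈⟨ ⁻¹-∙-comm _ _ ⟨
    - (suc m × 1#) - (suc n × 1#)         ∎

  fromℤ-pos-* : ∀ m j → fromℤ (+ m ℤ.* j) ≈ m × 1# * fromℤ j
  fromℤ-pos-* m (+ n)    =
    trans (reflexive (≡.cong fromℤ (≡.sym (ℤₚ.pos-* m n)))) (×1-homo-* m n)
  fromℤ-pos-* m -[1+ n ] = begin
    fromℤ (+ m ℤ.* (ℤ.- (+ suc n)))       ≡⟨ ≡.cong fromℤ (ℤₚ.neg-distribʳ-* (+ m) (+ suc n)) ⟨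
    fromℤ (ℤ.- (+ m ℤ.* + suc n))         ≈⟨ fromℤ-neg (+ m ℤ.* + suc n) ⟩
    - fromℤ (+ m ℤ.* + suc n)             ≈⟨ -‿cong (fromℤ-pos-* m (+ suc n)) ⟩
    - (m × 1# * suc n × 1#)               ≈⟨ -‿distribʳ-* _ _ ⟩
    m × 1# * - (suc n × 1#)               ∎

  fromℤ-* : ∀ i j → fromℤ (i ℤ.* j) ≈ fromℤ i * fromℤ j
  fromℤ-* (+ m)    j = fromℤ-pos-* m j
  fromℤ-* -[1+ m ] j = begin
    fromℤ ((ℤ.- (+ suc m)) ℤ.* j)         ≡⟨ ≡.cong fromℤ (ℤₚ.neg-distribˡ-* (+ suc m) j) ⟨
    fromℤ (ℤ.- (+ suc m ℤ.* j))           ≈⟨ fromℤ-neg (+ suc m ℤ.* j) ⟩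
    - fromℤ (+ suc m ℤ.* j)               ≈⟨ -‿cong (fromℤ-pos-* (suc m) j) ⟩
    - (suc m × 1# * fromℤ j)              ≈⟨ -‿distribˡ-* _ _ ⟩
    - (suc m × 1#) * fromℤ j              ∎

  homomorphism : ℤ.+-*-rawRing -Raw-AlmostCommutative⟶ fromCommutativeRing R
  homomorphism = record
    { ⟦_⟧    = fromℤ
    ; +-homo = fromℤ-+
    ; *-homo = fromℤ-*
    ; -‿homo = fromℤ-neg
    ; 0-homo = refl
    ; 1-homo = refl
    }

  -- Distinct integers may still coincide in R, so inequality of integers yields no verdict.
  fromℤ-≟ : ∀ i j → Maybe (fromℤ i ≈ fromℤ j)
  fromℤ-≟ i j with i ℤ.≟ j
  ... | yes i≡j = just (reflexive (≡.cong fromℤ i≡j))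
  ... | no  _   = nothing

  open Algebra.Solver.Ring ℤ.+-*-rawRing (fromCommutativeRing R) homomorphism fromℤ-≟ public
    using (solve; _:=_; _:+_; _:*_; _:-_; :-_; con; Polynomial)

  :0 :1 : ∀ {n} → Polynomial n
  :0 = con (+ 0)
  :1 = con (+ 1)

  infixl 6 _⟨+⟩_
  infixl 7 _⟨*⟩_

  _⟨*⟩_ : ∀ z {x y} → x ≈ y → z * (x - y) ≈ 0#
  z ⟨*⟩ x≈y = trans (*-congˡ (x≈y⇒x∙y⁻¹≈ε x≈y)) (zeroʳ z)

  _⟨+⟩_ : ∀ {x y} → x ≈ 0# → y ≈ 0# → x + y ≈ 0#
  x≈0 ⟨+⟩ y≈0 = trans (+-cong x≈0 y≈0) (+-identityˡ 0#)

  -- Certificate proofs: the solver checks x - y = Σ zᵢ (xᵢ - yᵢ) as a polynomial identity, and each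
  -- known equation xᵢ ≈ yᵢ kills its summand. Cofactors zᵢ written as `_` are read off from that
  -- identity.
  linear-combination : ∀ {x y z} → x - y ≈ z → z ≈ 0# → x ≈ y
  linear-combination {x} {y} x-y≈z z≈0 = x∙y⁻¹≈ε⇒x≈y x y (trans x-y≈z z≈0)

-- Cauchy products, geometric series and finite sums.

module PowerSeries {c ℓ} (R : CommutativeRing c ℓ) where
  open CommutativeRing R
  open IntegerCoefficients R
  open Series R
  open import Relation.Binary.Reasoning.Setoid setoid

  tail : PS → PS
  tail A n = A (suc n)

  ⊛-linearˡ : ∀ {A B D : PS} {a b} (G : PS) → (∀ i → A i ≈ a * B i + b * D i) →
              ∀ n → (A ⊛ G) n ≈ a * (B ⊛ G) n + b * (D ⊛ G) n
  ⊛-linearˡ {A} {B} {D} {a} {b} G A≈ zero = begin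
    A 0 * G 0 + 0#                          ≈⟨ +-congʳ (*-congʳ (A≈ 0)) ⟩
    (a * B 0 + b * D 0) * G 0 + 0#          ≈⟨ solve 5 (λ a b x y g → (a :* x :+ b :* y) :* g :+ :0
                                                 := a :* (x :* g :+ :0) :+ b :* (y :* g :+ :0)) refl a b (B 0) (D 0) (G 0) ⟩
    a * (B 0 * G 0 + 0#) + b * (D 0 * G 0 + 0#) ∎
  ⊛-linearˡ {A} {B} {D} {a} {b} G A≈ (suc n) = begin
    A 0 * G (suc n) + (tail A ⊛ G) n
      ≈⟨ +-cong (*-congʳ (A≈ 0)) (⊛-linearˡ G (A≈ ∘ suc) n) ⟩
    (a * B 0 + b * D 0) * G (suc n) + (a * (tail B ⊛ G) n + b * (tail D ⊛ G) n)
      ≈⟨ solve 7 (λ a b x y g s t → (a :* x :+ b :* y) :* g :+ (a :* s :+ b :* t)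
           := a :* (x :* g :+ s) :+ b :* (y :* g :+ t)) refl a b (B 0) (D 0) (G (suc n)) ((tail B ⊛ G) n) ((tail D ⊛ G) n) ⟩
    a * (B ⊛ G) (suc n) + b * (D ⊛ G) (suc n) ∎

  ⊛-assoc : ∀ (A B G : PS) n → ((A ⊛ B) ⊛ G) n ≈ (A ⊛ (B ⊛ G)) n
  ⊛-assoc A B G zero = solve 3 (λ a b g → (a :* b :+ :0) :* g :+ :0 := a :* (b :* g :+ :0) :+ :0) refl (A 0) (B 0) (G 0)
  ⊛-assoc A B G (suc n) = begin
    (A 0 * B 0 + 0#) * G (suc n) + (tail (A ⊛ B) ⊛ G) n
      -- The tail of A B is A₀ · tail B + tail A · B, so linearity in the left factor reduces the
      -- claim to `tail A`.
      ≈⟨ +-congˡ (⊛-linearˡ {B = tail B} {D = tail A ⊛ B} G (λ _ → +-congˡ (sym (*-identityˡ _))) n) ⟩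
    (A 0 * B 0 + 0#) * G (suc n) + (A 0 * (tail B ⊛ G) n + 1# * ((tail A ⊛ B) ⊛ G) n)
      ≈⟨ +-congˡ (+-congˡ (*-congˡ (⊛-assoc (tail A) B G n))) ⟩
    (A 0 * B 0 + 0#) * G (suc n) + (A 0 * (tail B ⊛ G) n + 1# * (tail A ⊛ (B ⊛ G)) n)
      ≈⟨ solve 5 (λ a b g s t → (a :* b :+ :0) :* g :+ (a :* s :+ :1 :* t) := a :* (b :* g :+ s) :+ t)
           refl (A 0) (B 0) (G (suc n)) ((tail B ⊛ G) n) ((tail A ⊛ (B ⊛ G)) n) ⟩
    (A ⊛ (B ⊛ G)) (suc n) ∎

  ⊛-identityˡ : ∀ (A : PS) n → (oneS ⊛ A) n ≈ A n
  ⊛-identityˡ A zero    = trans (+-identityʳ _) (*-identityˡ _)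
  ⊛-identityˡ A (suc n) = begin
    1# * A (suc n) + (tail oneS ⊛ A) n
      -- The zero series `tail oneS` is presented as 0 · 1 + 0 · 1, which makes linearity
      -- applicable.
      ≈⟨ +-congˡ (⊛-linearˡ {B = oneS} {D = oneS} A (λ i → solve 1 (λ x → :0 := :0 :* x :+ :0 :* x) refl (oneS i)) n) ⟩
    1# * A (suc n) + (0# * (oneS ⊛ A) n + 0# * (oneS ⊛ A) n)
      ≈⟨ solve 2 (λ a x → :1 :* a :+ (:0 :* x :+ :0 :* x) := a) refl (A (suc n)) ((oneS ⊛ A) n) ⟩
    A (suc n) ∎

  ⊛-identityʳ : ∀ (A : PS) n → (A ⊛ oneS) n ≈ A n
  ⊛-identityʳ A zero    = trans (+-identityʳ _) (*-identityʳ _)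
  ⊛-identityʳ A (suc n) = trans (+-cong (zeroʳ _) (⊛-identityʳ (tail A) n)) (+-identityˡ _)

  -- The two series are kept apart because the induction shortens `f` while the prefix still belongs
  -- to `F`.
  foldr-geoPrefix : ∀ (f F : PS) n →
    foldr _ _+_ 0# (zipWith _*_ (tabulate (λ (i : Fin (suc n)) → f (toℕ i))) (geoPrefix F n))
      ≈ (f ⊛ invOneMinusZ F) n
  foldr-geoPrefix f F zero    = refl
  foldr-geoPrefix f F (suc n) = +-congˡ (foldr-geoPrefix (tail f) F n)

  invOneMinusZ-suc : ∀ (F : PS) n → invOneMinusZ F (suc n) ≈ (F ⊛ invOneMinusZ F) n
  invOneMinusZ-suc F n = foldr-geoPrefix F F n

  sumℕ : ℕ → (ℕ → Carrier) → Carrier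
  sumℕ n φ = sumFin n (φ ∘ toℕ)

  sumℕ-last : ∀ n φ → sumℕ (suc n) φ ≈ sumℕ n φ + φ n
  sumℕ-last zero    φ = +-comm _ _
  sumℕ-last (suc n) φ = trans (+-congˡ (sumℕ-last n (φ ∘ suc))) (sym (+-assoc _ _ _))

  sumℕ-scale : ∀ n a {φ ψ : ℕ → Carrier} → (∀ i → i < n → φ i ≈ a * ψ i) → sumℕ n φ ≈ a * sumℕ n ψ
  sumℕ-scale zero    a φ≈aψ = sym (zeroʳ a)
  sumℕ-scale (suc n) a φ≈aψ =
    trans (+-cong (φ≈aψ 0 (s≤s z≤n)) (sumℕ-scale n a (λ i i<n → φ≈aψ (suc i) (s≤s i<n)))) (sym (distribˡ _ _ _))

  pow-+ : ∀ a m n → pow a (m ℕ.+ n) ≈ pow a m * pow a n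
  pow-+ a zero    n = sym (*-identityˡ _)
  pow-+ a (suc m) n = trans (*-congˡ (pow-+ a m n)) (sym (*-assoc _ _ _))

-- Even and odd indices.

double : ℕ → ℕ
double zero    = zero
double (suc n) = suc (suc (double n))

double≡n+n : ∀ n → double n ≡ n ℕ.+ n
double≡n+n zero    = ≡.refl
double≡n+n (suc n) = ≡.cong suc (≡.trans (≡.cong suc (double≡n+n n)) (≡.sym (ℕₚ.+-suc n n)))

isOdd-double : ∀ n → isOdd (double n) ≡ false
isOdd-double zero    = ≡.refl
isOdd-double (suc n) = isOdd-double n

isOdd-suc-double : ∀ n → isOdd (suc (double n)) ≡ true
isOdd-suc-double zero    = ≡.refl
isOdd-suc-double (suc n) = isOdd-suc-double n

-- Truncated continued fractions and products of tails.

module Convergents {c ℓ} (R : CommutativeRing c ℓ) (q y y⁻ : CommutativeRing.Carrier R) where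
  open CommutativeRing R
  open IntegerCoefficients R
  open Series R
  open Series.Data R q y y⁻
  open PowerSeries R
  open import Relation.Binary.Reasoning.Setoid setoid

  -- h n is the product of the first n tails of the continued fraction:
  -- h (n − 1) = (1 + z) h n − λₙ z h (n + 1).
  h : ℕ → PS
  h zero    j       = oneS j
  h (suc n) zero    = 1#
  h (suc n) (suc j) = h n (suc j) - h (suc n) j + lam (suc n) * h (suc (suc n)) j

  h-zero : ∀ n → h n 0 ≈ 1#
  h-zero zero    = refl
  h-zero (suc n) = refl

  cf-zero : ∀ k m → cf k m 0 ≈ 1#
  cf-zero k zero    = refl
  cf-zero k (suc m) = refl

  -- Clearing the denominator in C = 1 / (1 + z - λ z C′) gives C = 1 - z C + λ z C′ C; this is its
  -- coefficient of z^(n+1).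
  cf-suc : ∀ k m n → cf k (suc m) (suc n) ≈ (- 1#) * cf k (suc m) n + lam k * (cf (suc k) m ⊛ cf k (suc m)) n
  cf-suc k m n = begin
    cf k (suc m) (suc n)
      ≈⟨ invOneMinusZ-suc _ n ⟩
    ((λ i → - (0# + oneS i - lam k * cf (suc k) m i)) ⊛ cf k (suc m)) n
      ≈⟨ ⊛-linearˡ {B = oneS} {D = cf (suc k) m} (cf k (suc m)) (λ i → solve 3 (λ o l x → :- (:0 :+ o :- l :* x) := (:- :1) :* o :+ l :* x)
           refl (oneS i) (lam k) (cf (suc k) m i)) n ⟩
    (- 1#) * (oneS ⊛ cf k (suc m)) n + lam k * (cf (suc k) m ⊛ cf k (suc m)) n
      ≈⟨ +-congʳ (*-congˡ (⊛-identityˡ (cf k (suc m)) n)) ⟩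
    (- 1#) * cf k (suc m) n + lam k * (cf (suc k) m ⊛ cf k (suc m)) n ∎

  -- Induction on the precision j. Multiply C = 1 - z C + λ z C′ C by A: the factor z means that C A
  -- and C′ (C A) are needed only to one order less, matching the smaller depth of C′. `A` is
  -- arbitrary so that C A, which agrees with `h (suc n)`, can take its place.
  cf-⊛-h : ∀ j n m (A : PS) → j ≤ m → (∀ i → i ≤ j → A i ≈ h n i) →
           ∀ i → i ≤ j → (cf (suc n) m ⊛ A) i ≈ h (suc n) i
  cf-⊛-h j n m A j≤m A≈h zero i≤j = begin
    cf (suc n) m 0 * A 0 + 0#  ≈⟨ +-congʳ (*-cong (cf-zero (suc n) m) (trans (A≈h 0 z≤n) (h-zero n))) ⟩
    1# * 1# + 0#               ≈⟨ solve 0 (:1 :* :1 :+ :0 := :1) refl ⟩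
    1#                         ∎
  cf-⊛-h (suc j) n (suc m) A (s≤s j≤m) A≈h (suc i) (s≤s i≤j) = begin
    C 0 * A (suc i) + (tail C ⊛ A) i
      ≈⟨ +-cong (*-cong (cf-zero (suc n) (suc m)) (A≈h (suc i) (s≤s i≤j))) (⊛-linearˡ {B = C} {D = C′ ⊛ C} A (cf-suc (suc n) m) i) ⟩
    1# * h n (suc i) + ((- 1#) * (C ⊛ A) i + lam (suc n) * ((C′ ⊛ C) ⊛ A) i)
      ≈⟨ +-congˡ (+-cong (*-congˡ (C⊛A≈h i i≤j)) (*-congˡ (trans (⊛-assoc C′ C A i)
           (cf-⊛-h j (suc n) m (C ⊛ A) j≤m C⊛A≈h i i≤j)))) ⟩
    1# * h n (suc i) + ((- 1#) * h (suc n) i + lam (suc n) * h (suc (suc n)) i)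
      ≈⟨ solve 4 (λ a b l d → :1 :* a :+ ((:- :1) :* b :+ l :* d) := a :- b :+ l :* d)
           refl (h n (suc i)) (h (suc n) i) (lam (suc n)) (h (suc (suc n)) i) ⟩
    h (suc n) (suc i) ∎
    where
    C C′ : PS
    C  = cf (suc n) (suc m)
    C′ = cf (suc (suc n)) m
    C⊛A≈h : ∀ i → i ≤ j → (C ⊛ A) i ≈ h (suc n) i
    C⊛A≈h = cf-⊛-h j n (suc m) A (ℕₚ.m≤n⇒m≤1+n j≤m) (λ i i≤j → A≈h i (ℕₚ.m≤n⇒m≤1+n i≤j))

  truncation≈h : ∀ m n → n ≤ m → truncation m n ≈ h 1 n
  truncation≈h m n n≤m = begin
    cf 1 m n            ≈⟨ ⊛-identityʳ (cf 1 m) n ⟨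
    (cf 1 m ⊛ oneS) n   ≈⟨ cf-⊛-h n 0 m oneS n≤m (λ _ _ → refl) n ℕₚ.≤-refl ⟩
    h 1 n               ∎

-- The λₙ as polynomials in powers of p.

module Remainders {c ℓ} (R : CommutativeRing c ℓ) (q y y⁻ : CommutativeRing.Carrier R)
  (y*y⁻≈1 : CommutativeRing._≈_ R (CommutativeRing._*_ R y y⁻) (CommutativeRing.1# R)) where
  open CommutativeRing R hiding (zero)
  open IntegerCoefficients R
  open Series R
  open Series.Data R q y y⁻
  open PowerSeries R
  open Convergents R q y y⁻
  open import Relation.Binary.Reasoning.Setoid setoid

  p Q : Carrier
  p = q * q
  Q = q * (y + y⁻)

  oddλ evenλ C : Carrier → Carrier
  oddλ x  = 1# + x * x * p + x * Q
  evenλ x = (1# - x) * (1# - x)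
  C x     = 1# + 1# - oddλ x - evenλ x

  pow-q-double : ∀ n → pow q (double n) ≈ pow p n
  pow-q-double zero    = refl
  pow-q-double (suc n) = trans (*-congˡ (*-congˡ (pow-q-double n))) (sym (*-assoc _ _ _))

  lam-odd : ∀ r → lam (suc (double r)) ≈ oddλ (pow p r)
  lam-odd r rewrite isOdd-suc-double r = begin
    (1# + q * pow q (double r) * y) * (1# + q * pow q (double r) * y⁻)
      ≈⟨ *-cong (+-congˡ (*-congʳ (*-congˡ (pow-q-double r)))) (+-congˡ (*-congʳ (*-congˡ (pow-q-double r)))) ⟩
    (1# + q * x * y) * (1# + q * x * y⁻)
      ≈⟨ linear-combination (solve 4 (λ q x y y⁻ →
           (:1 :+ q :* x :* y) :* (:1 :+ q :* x :* y⁻) :- (:1 :+ x :* x :* (q :* q) :+ x :* (q :* (y :+ y⁻)))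
             := x :* x :* (q :* q) :* (y :* y⁻ :- :1)) refl q x y y⁻)
           (x * x * p ⟨*⟩ y*y⁻≈1) ⟩
    oddλ x ∎
    where
    x : Carrier
    x = pow p r

  lam-even : ∀ r → lam (double r) ≈ evenλ (pow p r)
  lam-even r rewrite isOdd-double r = *-cong 1-q≈ 1-q≈
    where
    1-q≈ : 1# - pow q (double r) ≈ 1# - pow p r
    1-q≈ = +-congˡ (-‿cong (pow-q-double r))

  -- The coefficients of f, the first-order relation and the order of vanishing.

  t : ℕ → Carrier
  t s = pow q s * (pow y s + pow y⁻ s)

  -- Since y y⁻ = 1, the elements q y and q y⁻ have sum Q and product p, and `t` is their power sum.
  t-rec : ∀ s → t (suc (suc s)) ≈ Q * t (suc s) - p * t s
  t-rec s = linear-combination (solve 6 (λ q y y⁻ x a b →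
      q :* (q :* x) :* (y :* (y :* a) :+ y⁻ :* (y⁻ :* b))
        :- (q :* (y :+ y⁻) :* (q :* x :* (y :* a :+ y⁻ :* b)) :- q :* q :* (x :* (a :+ b)))
        := (:- (q :* q :* x :* (a :+ b))) :* (y :* y⁻ :- :1))
      refl q y y⁻ (pow q s) (pow y s) (pow y⁻ s))
    (_ ⟨*⟩ y*y⁻≈1)

  -- F (k + 1) is the k-th coefficient of lhs; the value −1 at k = −1 extends the
  -- recurrence, since t 0 = 2.
  F : PS
  F zero    = - 1#
  F (suc s) = pow p s * F s + t s

  ladder : (x P a b b′ : Carrier) → Carrier
  ladder x P a b b′ = P * a + (1# - p * x) * ((x - P) * b′ + (1# - P * x) * b)

  -- The second argument stands for K + 1, so that K = -1 is available. At K = -1 the level r + 1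
  -- holds [z^r] G₂ᵣ₊₂, which lies below the order of vanishing.
  g : ℕ → PS
  g zero    s       = F s
  g (suc r) zero    = 0#
  g (suc r) (suc s) = ladder (pow p r) (pow p s) (g (suc r) s) (g r s) (g r (suc s))

  ladder-zero : ∀ x P {a b b′} → a ≈ 0# → b ≈ 0# → b′ ≈ 0# → ladder x P a b b′ ≈ 0#
  ladder-zero x P a≈0 b≈0 b′≈0 =
    trans (+-cong (*-congˡ a≈0) (*-congˡ (+-cong (*-congˡ b′≈0) (*-congˡ b≈0))))
          (solve 3 (λ p x P → P :* :0 :+ (:1 :- p :* x) :* ((x :- P) :* :0 :+ (:1 :- P :* x) :* :0) := :0) refl p x P)

  ladder-diagonal : ∀ x {a b} b′ → a ≈ 0# → b ≈ 0# → ladder x x a b b′ ≈ 0#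
  ladder-diagonal x b′ a≈0 b≈0 =
    trans (+-cong (*-congˡ a≈0) (*-congˡ (+-congˡ (*-congˡ b≈0))))
          (solve 3 (λ p x b′ → x :* :0 :+ (:1 :- p :* x) :* ((x :- x) :* b′ :+ (:1 :- x :* x) :* :0) := :0) refl p x b′)

  -- Below the diagonal every input of the relation vanishes already. On the diagonal the one input
  -- that need not vanish carries the factor p^r - p^s = 0; at r = 0 the factor 1 - p^(r+s) is 0 as
  -- well, which disposes of `F 0`.
  g-vanishes : ∀ r s → s ≤ suc r → g (suc r) s ≈ 0#
  g-vanishes r zero s≤1+r = refl
  g-vanishes r (suc s) (s≤s s≤r) with ℕₚ.m≤n⇒m<n∨m≡n s≤r
  g-vanishes (suc r) (suc s) (s≤s s≤r) | inj₁ s<r =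
    ladder-zero (pow p (suc r)) (pow p s) (g-vanishes (suc r) s (ℕₚ.m≤n⇒m≤1+n s≤r))
      (g-vanishes r s s≤r) (g-vanishes r (suc s) s<r)
  g-vanishes zero .(suc zero) _ | inj₂ ≡.refl =
    solve 3 (λ p f₀ f₁ → :1 :* :0 :+ (:1 :- p :* :1) :* ((:1 :- :1) :* f₁ :+ (:1 :- :1 :* :1) :* f₀) := :0) refl p (F 0) (F 1)
  g-vanishes (suc r) .(suc (suc r)) _ | inj₂ ≡.refl =
    ladder-diagonal (pow p (suc r)) (g (suc r) (suc (suc r)))
      (g-vanishes (suc r) (suc r) (ℕₚ.n≤1+n (suc r))) (g-vanishes r (suc r) ℕₚ.≤-refl)

  -- The three-term recurrence.

  d : ℕ → Carrier
  d r = evenλ (pow p (suc r)) * oddλ (pow p r)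

  e : ℕ → PS
  e zero    s = 0#
  e (suc r) s = d r * g r s

  :oddλ :C : ∀ {n} (p Q x : Polynomial n) → Polynomial n
  :evenλ : ∀ {n} (x : Polynomial n) → Polynomial n
  :oddλ p Q x = :1 :+ x :* x :* p :+ x :* Q
  :evenλ x    = (:1 :- x) :* (:1 :- x)
  :C p Q x    = :1 :+ :1 :- :oddλ p Q x :- :evenλ x

  :ladder : ∀ {n} (p x P a b b′ : Polynomial n) → Polynomial n
  :ladder p x P a b b′ = P :* a :+ (:1 :- p :* x) :* ((x :- P) :* b′ :+ (:1 :- P :* x) :* b)

  -- The relation defining g r, multiplied so as to absorb the coefficient of e r;
  -- in this form it also holds at r = 0, where both sides are 0.
  lower-ladder : ∀ r s → let u = pow p r; P = pow p s in
    (1# - u) * (p + u * u + u * Q) * (g r (suc (suc s)) - p * P * g r (suc s))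
      ≈ (u - p * (p * P)) * e r (suc (suc s)) + p * (1# - P * u) * e r (suc s)
  lower-ladder zero s =
    solve 5 (λ p Q P b₀ b₁ →
        (:1 :- :1) :* (p :+ :1 :* :1 :+ :1 :* Q) :* (b₁ :- p :* P :* b₀)
          := (:1 :- p :* (p :* P)) :* :0 :+ p :* (:1 :- P :* :1) :* :0)
      refl p Q (pow p s) (F (suc s)) (F (suc (suc s)))
  lower-ladder (suc r) s =
    solve 7 (λ p Q x P b c₀ c₁ → let u = p :* x; d = :evenλ u :* :oddλ p Q x in
        (:1 :- u) :* (p :+ u :* u :+ u :* Q) :* (:ladder p x (p :* P) b c₀ c₁ :- p :* P :* b)
          := (u :- p :* (p :* P)) :* (d :* c₁) :+ p :* (:1 :- P :* u) :* (d :* c₀))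
      refl p Q (pow p r) (pow p s) (g (suc r) (suc s)) (g r (suc s)) (g r (suc (suc s)))

  -- Eliminating the odd-indexed remainders gives G₂ᵣ₊₂ = (1 + C z + z²) G₂ᵣ - λ₂ᵣ₋₁ λ₂ᵣ z² G₂ᵣ₋₂,
  -- here read off coefficientwise; `d r` is λ₂ᵣ₊₁ λ₂ᵣ₊₂.
  three-term : ∀ r s →
    g (suc r) (suc s) ≈ g r (suc (suc s)) + g r s + C (pow p r) * g r (suc s) - e r (suc s)
  three-term zero zero =
    solve 3 (λ q y y⁻ → let p = q :* q; Q = q :* (y :+ y⁻)
                            F₀ = :- :1; F₁ = :1 :* F₀ :+ :1 :* (:1 :+ :1)
                            F₂ = p :* :1 :* F₁ :+ q :* :1 :* (y :* :1 :+ y⁻ :* :1) in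
        :ladder p :1 :1 :0 F₀ F₁ := F₂ :+ F₀ :+ :C p Q :1 :* F₁ :- :0)
      refl q y y⁻
  three-term zero (suc s) = linear-combination
    (solve 8 (λ p Q P f t₀ t₁ t₂ G → let
                                         f₁ = P :* f :+ t₀; f₂ = p :* P :* f₁ :+ t₁
                                         f₃ = p :* (p :* P) :* f₂ :+ t₂ in
        :ladder p :1 (p :* P) G f₁ f₂ :- (f₃ :+ f₁ :+ :C p Q :1 :* f₂ :- :0)
          -- The defect at s + 1 is p^(s+1) times the defect at s, up to the recurrence for `t`.
          := p :* P :* (G :- (f₂ :+ f :+ :C p Q :1 :* f₁ :- :0)) :+ (:- :1) :* (t₂ :- (Q :* t₁ :- p :* t₀)))
      refl p Q (pow p s) (F s) (t s) (t (suc s)) (t (suc (suc s))) (g 1 (suc s)))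
    (pow p (suc s) ⟨*⟩ three-term zero s ⟨+⟩ (- 1#) ⟨*⟩ t-rec s)
  -- Here `e 1 1` contains `F 1`, which equals 1, so vanishing alone does not settle the case.
  three-term (suc zero) zero =
    solve 3 (λ q y y⁻ → let p = q :* q; Q = q :* (y :+ y⁻)
                            F₀ = :- :1; F₁ = :1 :* F₀ :+ :1 :* (:1 :+ :1)
                            F₂ = p :* :1 :* F₁ :+ q :* :1 :* (y :* :1 :+ y⁻ :* :1)
                            g₁ = :ladder p :1 :1 :0 F₀ F₁; g₂ = :ladder p :1 (p :* :1) g₁ F₁ F₂ in
        :ladder p (p :* :1) :1 :0 :0 g₁
          := g₂ :+ :0 :+ :C p Q (p :* :1) :* g₁ :- :evenλ (p :* :1) :* :oddλ p Q :1 :* F₁)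
      refl q y y⁻
  three-term (suc (suc r)) zero = begin
    g (3 ℕ.+ r) 1
      ≈⟨ g-vanishes (2 ℕ.+ r) 1 (s≤s z≤n) ⟩
    0#
      ≈⟨ solve 2 (λ x z → :0 := :0 :+ :0 :+ x :* :0 :- z :* :0) refl (C (pow p (2 ℕ.+ r))) (d (suc r)) ⟩
    0# + 0# + C (pow p (2 ℕ.+ r)) * 0# - d (suc r) * 0#
      ≈⟨ +-cong (+-cong (+-congʳ (g-vanishes (suc r) 2 (s≤s (s≤s z≤n)))) (*-congˡ (g-vanishes (suc r) 1 (s≤s z≤n))))
                (-‿cong (*-congˡ (g-vanishes r 1 (s≤s z≤n)))) ⟨
    g (2 ℕ.+ r) 2 + g (2 ℕ.+ r) 0 + C (pow p (2 ℕ.+ r)) * g (2 ℕ.+ r) 1 - e (2 ℕ.+ r) 1 ∎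
  three-term (suc r) (suc s) = linear-combination
    (solve 12 (λ p P u Q a b₋ b₀ b₁ b₂ e₀ e₁ G → let
          v  = p :* u
          d  = :evenλ v :* :oddλ p Q u
          a₀ = :ladder p u P a b₋ b₀
          a₁ = :ladder p u (p :* P) a₀ b₀ b₁
          a₂ = :ladder p u (p :* (p :* P)) a₁ b₁ b₂
        in
        :ladder p v (p :* P) G a₀ a₁ :- (a₂ :+ a₀ :+ :C p Q v :* a₁ :- d :* b₁)
          -- The defect is combined from those at (r + 1, s), (r, s) and (r, s + 1). The last
          -- summand, from `lower-ladder`, cancels the e-terms that the two defects at level r bring
          -- in.
          :=  p :* P :* (G :- (a₁ :+ a :+ :C p Q v :* a₀ :- d :* b₀))
           :+ p :* (:1 :- v) :* (:1 :- P :* u) :* (a₀ :- (b₁ :+ b₋ :+ :C p Q u :* b₀ :- e₀))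
           :+ (:1 :- v) :* (u :- p :* (p :* P)) :* (a₁ :- (b₂ :+ b₀ :+ :C p Q u :* b₁ :- e₁))
           :+ (:1 :- v) :* ((:1 :- u) :* (p :+ u :* u :+ u :* Q) :* (b₁ :- p :* P :* b₀)
                             :- ((u :- p :* (p :* P)) :* e₁ :+ p :* (:1 :- P :* u) :* e₀)))
      refl p (pow p s) (pow p r) Q (g (suc r) s) (g r s) (g r (suc s)) (g r (suc (suc s))) (g r (suc (suc (suc s))))
        (e r (suc s)) (e r (suc (suc s))) (g (suc (suc r)) (suc s)))
    (_ ⟨*⟩ three-term (suc r) s ⟨+⟩ _ ⟨*⟩ three-term r s ⟨+⟩ _ ⟨*⟩ three-term r (suc s) ⟨+⟩ _ ⟨*⟩ lower-ladder r s)

  -- Two-step recurrence for the products of tails.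

  h-previous : ℕ → PS
  -- This stands for h₋₁ = (1 + z) h₀ - λ₀ z h₁ = 1 + z, as λ₀ = 0; only its coefficients from z² on
  -- are used.
  h-previous zero    j = 0#
  h-previous (suc r) j = h (suc (double r)) j

  -- The coefficient of z^(i+2) in hₙ₋₂ = (1 + C z + z²) hₙ - λₙ λₙ₊₁ z² hₙ₊₂, obtained by
  -- eliminating the even-indexed products.
  h-contract : ∀ r i → let n = suc (double r) in
    h n (2 ℕ.+ i) ≈ h-previous r (2 ℕ.+ i) - C (pow p r) * h n (1 ℕ.+ i) - h n i + d r * h (2 ℕ.+ n) i
  h-contract zero i = linear-combination
    (solve 7 (λ p Q l₁ l₂ h₁ h₂ h₃ → let
          h₁′ = :0 :- h₁ :+ l₁ :* h₂
          h₂′ = h₁′ :- h₂ :+ l₂ :* h₃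
        in
        (:0 :- h₁′ :+ l₁ :* h₂′) :- (:0 :- :C p Q :1 :* h₁′ :- h₁ :+ :evenλ (p :* :1) :* :oddλ p Q :1 :* h₃)
          := (h₁′ :+ l₂ :* h₃) :* (l₁ :- :oddλ p Q :1) :+ :oddλ p Q :1 :* h₃ :* (l₂ :- :evenλ (p :* :1)))
      refl p Q (lam 1) (lam 2) (h 1 i) (h 2 i) (h 3 i))
    (_ ⟨*⟩ lam-odd 0 ⟨+⟩ _ ⟨*⟩ lam-even 1)
  h-contract (suc r) i = linear-combination
    (solve 11 (λ p Q x l₁ l₂ l₃ h₀″ h₁′ h₂ h₃ h₄ → let
          v   = p :* x
          h₂′ = h₁′ :- h₂ :+ l₂ :* h₃
          h₃′ = h₂′ :- h₃ :+ l₃ :* h₄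
          h₁″ = h₀″ :- h₁′ :+ l₁ :* h₂′
        in
        (h₁″ :- h₂′ :+ l₂ :* h₃′) :- (h₀″ :- :C p Q v :* h₂′ :- h₂ :+ :evenλ (p :* v) :* :oddλ p Q v :* h₄)
          := h₂′ :* (l₁ :- :evenλ v) :+ (h₂′ :+ l₃ :* h₄) :* (l₂ :- :oddλ p Q v)
           :+ :oddλ p Q v :* h₄ :* (l₃ :- :evenλ (p :* v)))
      refl p Q (pow p r) (lam (1 ℕ.+ n)) (lam (2 ℕ.+ n)) (lam (3 ℕ.+ n))
        (h n (2 ℕ.+ i)) (h (1 ℕ.+ n) (1 ℕ.+ i)) (h (2 ℕ.+ n) i) (h (3 ℕ.+ n) i) (h (4 ℕ.+ n) i))
    (_ ⟨*⟩ lam-even (suc r) ⟨+⟩ _ ⟨*⟩ lam-odd (suc r) ⟨+⟩ _ ⟨*⟩ lam-even (suc (suc r)))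
    where
    n : ℕ
    n = suc (double r)

  h-one : ∀ r → let n = suc (double r) in h (2 ℕ.+ n) 1 ≈ h n 1 - C (pow p (suc r))
  h-one r = linear-combination
    (solve 6 (λ p Q x l₁ l₂ a → let v = p :* x in
        (a :- :1 :+ l₁ :* :1) :- :1 :+ l₂ :* :1 :- (a :- :C p Q v)
          := :1 :* (l₁ :- :evenλ v) :+ :1 :* (l₂ :- :oddλ p Q v))
      refl p Q (pow p r) (lam (2 ℕ.+ double r)) (lam (3 ℕ.+ double r)) (h (suc (double r)) 1))
    (_ ⟨*⟩ lam-even (suc r) ⟨+⟩ _ ⟨*⟩ lam-odd (suc r))

  -- Comparison of the remainders with the products of tails.

  Λ : ℕ → Carrier
  Λ zero    = 1#
  Λ (suc r) = d r * Λ r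

  -- `three-term` and `h-contract` are the same recurrence up to the factor w, each solved for its
  -- highest coefficient at the given level.
  g≈Λh-step : ∀ {G X A B E H H′ H″ H₊ H₋ w c δ} →
    G ≈ X + B + c * A - E → H″ ≈ H₋ - c * H′ - H + δ * H₊ →
    G ≈ δ * w * H₊ → B ≈ w * H → A ≈ w * H′ → E ≈ w * H₋ → X ≈ w * H″
  g≈Λh-step {G} {X} {A} {B} {E} {H} {H′} {H″} {H₊} {H₋} {w} {c} {δ} G≈ H″≈ G≈δwH₊ B≈wH A≈wH′ E≈wH₋ =
    linear-combination
      (solve 13 (λ G X A B E H H′ H″ H₊ H₋ w c δ → X :- w :* H″
          := (:- :1) :* (G :- (X :+ B :+ c :* A :- E)) :+ (:- w) :* (H″ :- (H₋ :- c :* H′ :- H :+ δ :* H₊))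
          :+ :1 :* (G :- δ :* w :* H₊) :+ (:- :1) :* (B :- w :* H) :+ (:- c) :* (A :- w :* H′) :+ :1 :* (E :- w :* H₋))
        refl G X A B E H H′ H″ H₊ H₋ w c δ)
      (_ ⟨*⟩ G≈ ⟨+⟩ _ ⟨*⟩ H″≈ ⟨+⟩ _ ⟨*⟩ G≈δwH₊ ⟨+⟩ _ ⟨*⟩ B≈wH ⟨+⟩ _ ⟨*⟩ A≈wH′ ⟨+⟩ _ ⟨*⟩ E≈wH₋)

  -- This says G₂ᵣ = λ₁⋯λ₂ᵣ z²ʳ h₂ᵣ₊₁. The induction is lexicographic in (i, r): the case (i + 2, r)
  -- calls on (i, r + 1) and on (i + 2, r - 1). For i = 0 and i = 1 `g-vanishes` removes the terms
  -- below the leading coefficient.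
  g≈Λh : ∀ i r → g r (suc (i ℕ.+ r)) ≈ Λ r * h (suc (double r)) i
  g≈Λh zero zero = solve 0 (:1 :* (:- :1) :+ :1 :* (:1 :+ :1) := :1 :* :1) refl
  g≈Λh zero (suc r) = linear-combination
    (solve 7 (λ G X A B g₀ w δ → X :- δ :* w :* :1
        := (:- :1) :* (G :- (X :+ B :+ A :- δ :* g₀)) :+ :1 :* (G :- :0) :+ (:- :1) :* (B :- :0)
        :+ (:- :1) :* (A :- :0) :+ δ :* (g₀ :- w :* :1))
      refl (g (suc (suc r)) (suc r)) (g (suc r) (suc (suc r))) (C (pow p (suc r)) * g (suc r) (suc r))
        (g (suc r) r) (g r (suc r)) (Λ r) (d r))
    (_ ⟨*⟩ three-term (suc r) r ⟨+⟩ _ ⟨*⟩ g-vanishes (suc r) (suc r) (ℕₚ.n≤1+n (suc r))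
      ⟨+⟩ _ ⟨*⟩ g-vanishes r r (ℕₚ.n≤1+n r)
      ⟨+⟩ _ ⟨*⟩ trans (*-congˡ (g-vanishes r (suc r) ℕₚ.≤-refl)) (zeroʳ _) ⟨+⟩ _ ⟨*⟩ g≈Λh zero r)
  g≈Λh (suc zero) zero = linear-combination
    (solve 4 (λ q y y⁻ l₁ → let
          p = q :* q
          Q = q :* (y :+ y⁻)
          F₁ = :1 :* (:- :1) :+ :1 :* (:1 :+ :1)
        in
        p :* :1 :* F₁ :+ q :* :1 :* (y :* :1 :+ y⁻ :* :1) :- :1 :* (:0 :- :1 :+ l₁ :* :1)
          := (:- :1) :* (l₁ :- :oddλ p Q :1))
      refl q y y⁻ (lam 1))
    (_ ⟨*⟩ lam-odd 0)
  g≈Λh (suc zero) (suc r) = linear-combination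
    (solve 10 (λ G X A B g₀ w δ c H₀ H → X :- δ :* w :* H
        := (:- :1) :* (G :- (X :+ B :+ c :* A :- δ :* g₀)) :+ :1 :* (G :- :0) :+ (:- :1) :* (B :- :0)
        :+ (:- c) :* (A :- δ :* w :* :1) :+ δ :* (g₀ :- w :* H₀) :+ (:- (δ :* w)) :* (H :- (H₀ :- c)))
      refl (g (suc (suc r)) (suc (suc r))) (g (suc r) (suc (suc (suc r)))) (g (suc r) (suc (suc r)))
        (g (suc r) (suc r)) (g r (suc (suc r))) (Λ r) (d r) (C (pow p (suc r))) (h (suc (double r)) 1) (h (suc (double (suc r))) 1))
    (_ ⟨*⟩ three-term (suc r) (suc r) ⟨+⟩ _ ⟨*⟩ g-vanishes (suc r) (suc (suc r)) ℕₚ.≤-refl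
      ⟨+⟩ _ ⟨*⟩ g-vanishes r (suc r) ℕₚ.≤-refl ⟨+⟩ _ ⟨*⟩ g≈Λh zero (suc r) ⟨+⟩ _ ⟨*⟩ g≈Λh 1 r ⟨+⟩ _ ⟨*⟩ h-one r)
  g≈Λh (suc (suc i)) zero =
    g≈Λh-step (three-term zero (suc (i ℕ.+ zero))) (h-contract zero i)
      (trans (reflexive (≡.cong (g 1 ∘ suc) (≡.sym (ℕₚ.+-suc i zero)))) (g≈Λh i 1))
      (g≈Λh i zero) (g≈Λh (suc i) zero) (sym (zeroʳ 1#))
  g≈Λh (suc (suc i)) (suc r) =
    g≈Λh-step (three-term (suc r) (suc (i ℕ.+ suc r))) (h-contract (suc r) i)
      (trans (reflexive (≡.cong (g (suc (suc r)) ∘ suc) (≡.sym (ℕₚ.+-suc i (suc r))))) (g≈Λh i (suc (suc r))))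
      (g≈Λh i (suc r)) (g≈Λh (suc i) (suc r))
      (begin
        d r * g r (suc (suc (i ℕ.+ suc r)))       ≡⟨ ≡.cong (λ j → d r * g r (suc (suc j))) (ℕₚ.+-suc i r) ⟩
        d r * g r (suc (suc (suc i) ℕ.+ r))       ≈⟨ *-congˡ (g≈Λh (suc (suc i)) r) ⟩
        d r * (Λ r * h (suc (double r)) (2 ℕ.+ i)) ≈⟨ *-assoc _ _ _ ⟨
        Λ (suc r) * h (suc (double r)) (2 ℕ.+ i)  ∎)

  -- The first-order recurrence of the left-hand side.

  exponent : ℕ → ℤ → ℕ
  exponent k j = k ℕ.* suc k ∸ ∣ j ∣ ℕ.* ∣ j ∣

  lhs-term : ℕ → ℤ → Carrier
  lhs-term k j = ypow j * pow q (exponent k j)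

  exponent-edge : ∀ k → suc k ℕ.* suc (suc k) ∸ suc k ℕ.* suc k ≡ suc k
  exponent-edge k = ≡.trans (≡.cong (_∸ suc k ℕ.* suc k) (ℕₚ.*-suc (suc k) (suc k)))
                            (ℕₚ.m+n∸n≡m (suc k) (suc k ℕ.* suc k))

  ∣i⊖k∣≤k : ∀ i k → i ≤ k ℕ.+ k → ∣ i ℤ.⊖ k ∣ ≤ k
  ∣i⊖k∣≤k i k i≤2k with ℕₚ.≤-total i k
  ... | inj₁ i≤k = ≡.subst (_≤ k) (≡.sym (ℤₚ.∣⊖∣-≤ i≤k)) (ℕₚ.m∸n≤m k i)
  ... | inj₂ k≤i = ≡.subst (_≤ k) (≡.sym (≡.cong ∣_∣ (ℤₚ.⊖-≥ k≤i))) (ℕₚ.m≤n+o⇒m∸n≤o i k i≤2k)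

  -- (k + 1)(k + 2) exceeds k(k + 1) by 2(k + 1), and the bound on j keeps the truncated subtraction
  -- exact.
  exponent-suc : ∀ k j → ∣ j ∣ ≤ k → exponent (suc k) j ≡ double (suc k) ℕ.+ exponent k j
  exponent-suc k j ∣j∣≤k = ≡.trans (≡.cong (_∸ ∣ j ∣ ℕ.* ∣ j ∣) (≡.trans expand (≡.cong (ℕ._+ k ℕ.* suc k) (≡.sym (double≡n+n (suc k))))))
      (ℕₚ.+-∸-assoc (double (suc k)) (ℕₚ.*-mono-≤ ∣j∣≤k (ℕₚ.m≤n⇒m≤1+n ∣j∣≤k)))
    where
    open ℕSolver.+-*-Solver using () renaming (solve to ℕsolve; _:=_ to _≔_; _:+_ to _⊞_; _:*_ to _⊠_; con to const)
    expand : suc k ℕ.* suc (suc k) ≡ (suc k ℕ.+ suc k) ℕ.+ k ℕ.* suc k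
    expand = ℕsolve 1 (λ k → (const 1 ⊞ k) ⊠ (const 2 ⊞ k) ≔ ((const 1 ⊞ k) ⊞ (const 1 ⊞ k)) ⊞ k ⊠ (const 1 ⊞ k)) ≡.refl k

  lhs-term-suc : ∀ k i → i < suc (k ℕ.+ k) →
    lhs-term (suc k) (+ suc i ℤ.- + suc k) ≈ pow p (suc k) * lhs-term k (+ i ℤ.- + k)
  lhs-term-suc k i (s≤s i≤2k) = begin
    lhs-term (suc k) (+ suc i ℤ.- + suc k)
      ≡⟨ ≡.cong (lhs-term (suc k)) (≡.trans (ℤₚ.m-n≡m⊖n (suc i) (suc k)) (ℤₚ.[1+m]⊖[1+n]≡m⊖n i k)) ⟩
    ypow j * pow q (exponent (suc k) j)
      ≡⟨ ≡.cong (λ n → ypow j * pow q n) (exponent-suc k j (∣i⊖k∣≤k i k i≤2k)) ⟩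
    ypow j * pow q (double (suc k) ℕ.+ exponent k j)
      ≈⟨ *-congˡ (trans (pow-+ q (double (suc k)) (exponent k j)) (*-congʳ (pow-q-double (suc k)))) ⟩
    ypow j * (pow p (suc k) * pow q (exponent k j))
      ≈⟨ solve 3 (λ a b c → a :* (b :* c) := b :* (a :* c)) refl (ypow j) (pow p (suc k)) (pow q (exponent k j)) ⟩
    pow p (suc k) * lhs-term k j
      ≡⟨ ≡.cong (λ j → pow p (suc k) * lhs-term k j) (≡.sym (ℤₚ.m-n≡m⊖n i k)) ⟩
    pow p (suc k) * lhs-term k (+ i ℤ.- + k) ∎
    where
    j : ℤ
    j = i ℤ.⊖ k

  2k-k≡k : ∀ k → + (k ℕ.+ k) ℤ.- + k ≡ + k
  2k-k≡k k = ≡.trans (ℤₚ.m-n≡m⊖n (k ℕ.+ k) k)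
    (≡.trans (ℤₚ.⊖-≥ (ℕₚ.m≤m+n k k)) (≡.cong +_ (ℕₚ.m+n∸n≡m k k)))

  -- The inner terms reproduce coefficient k with a factor q^(2(k+1)); the two new ones, j = ±(k +
  -- 1), have q-exponent k + 1 and form `t (suc k)`.
  lhs-suc : ∀ k → lhs (suc k) ≈ pow p (suc k) * lhs k + t (suc k)
  lhs-suc k = begin
    first + sumℕ (suc k ℕ.+ suc k) (term ∘ suc)
      ≈⟨ +-congˡ (sumℕ-last (k ℕ.+ suc k) (term ∘ suc)) ⟩
    first + (sumℕ (k ℕ.+ suc k) (term ∘ suc) + term (suc k ℕ.+ suc k))
      ≡⟨ ≡.cong₂ (λ n j → first + (sumℕ n (term ∘ suc) + lhs-term (suc k) j)) (ℕₚ.+-suc k k) (2k-k≡k (suc k)) ⟩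
    first + (sumℕ (suc (k ℕ.+ k)) (term ∘ suc) + lhs-term (suc k) (+ suc k))
      ≈⟨ +-congˡ (+-congʳ (sumℕ-scale (suc (k ℕ.+ k)) (pow p (suc k)) (lhs-term-suc k))) ⟩
    first + (pow p (suc k) * lhs k + lhs-term (suc k) (+ suc k))
      ≡⟨ ≡.cong (λ n → pow y⁻ (suc k) * pow q n + (pow p (suc k) * lhs k + pow y (suc k) * pow q n)) (exponent-edge k) ⟩
    pow y⁻ (suc k) * pow q (suc k) + (pow p (suc k) * lhs k + pow y (suc k) * pow q (suc k))
      ≈⟨ solve 4 (λ a b x l → b :* x :+ (l :+ a :* x) := l :+ x :* (a :+ b))
           refl (pow y (suc k)) (pow y⁻ (suc k)) (pow q (suc k)) (pow p (suc k) * lhs k) ⟩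
    pow p (suc k) * lhs k + t (suc k) ∎
    where
    term : ℕ → Carrier
    term i = lhs-term (suc k) (+ i ℤ.- + suc k)
    first : Carrier
    first = lhs-term (suc k) -[1+ k ]

  lhs≈F : ∀ k → lhs k ≈ F (suc k)
  lhs≈F zero    = solve 0 (:1 :* :1 :+ :0 := :1 :* (:- :1) :+ :1 :* (:1 :+ :1)) refl
  lhs≈F (suc k) = trans (lhs-suc k) (+-congʳ (*-congˡ (lhs≈F k)))

  -- Agreement with the truncations.

  lhs≈truncation : ∀ m n → n ≤ m → lhs n ≈ truncation m n
  lhs≈truncation m n n≤m = begin
    lhs n                     ≈⟨ lhs≈F n ⟩
    F (suc n)                 ≡⟨ ≡.cong (F ∘ suc) (≡.sym (ℕₚ.+-identityʳ n)) ⟩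
    g 0 (suc (n ℕ.+ 0))       ≈⟨ g≈Λh n 0 ⟩
    1# * h 1 n                ≈⟨ *-identityˡ _ ⟩
    h 1 n                     ≈⟨ truncation≈h m n n≤m ⟨
    truncation m n            ∎

theorem7p1 : ∀ {c ℓ} (R : CommutativeRing c ℓ) (q y y⁻ : CommutativeRing.Carrier R) →
    CommutativeRing._≈_ R (CommutativeRing._*_ R y y⁻) (CommutativeRing.1# R) →
    (N : ℕ) → ∃ λ (M : ℕ) → (m : ℕ) → M ≤ m → (n : ℕ) → n ≤ N →
    CommutativeRing._≈_ R (Series.Data.lhs R q y y⁻ n) (Series.Data.truncation R q y y⁻ m n)
-- Truncation m is exact through z^m, so M = N suffices.
theorem7p1 R q y y⁻ y*y⁻≈1 N = N , λ m N≤m n n≤N → lhs≈truncation m n (ℕₚ.≤-trans n≤N N≤m)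
  where open Remainders R q y y⁻ y*y⁻≈1
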